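{- Let $n\geq 1$ and $q,\alpha,\beta\in\mathbb N$ with $\gcd(\alpha,\beta)=1$, and let $C(n,q\alpha)\in\{a<z\}^n$ and $C(n,q\beta)\in\{b<z\}^n$ be two superimposable Christoffel words. Let $r$ be an integer with $qr\equiv1\pmod n$. Then $C(n,q\alpha)$ and $\gamma^{1-r}\,\widetilde C(n,q\beta)$ are perfectly superimposable.
   Context: $\mathbb N=\{0,1,2,\dots\}$. For coprime $s,t\in\mathbb N$ and $n=s+t$, the Christoffel word over the ordered alphabet $\{a<z\}$ with $s$ occurrences of $a$ and $t$ occurrences of $z$ is $u=u[0]u[1]\cdots u[n-1]$ with $u[i]=a$ if $((i+1)t \bmod n)>(it\bmod n)$ and $u[i]=z$ otherwise. It is denoted $C(n,s)$; calling $C(n,s)$ a Christoffel word presupposes $\gcd(n,s)=1$. Over $\{b<z\}$ the definition is the same with $b$ in place of $a$. $\widetilde C(n,s)$ denotes the reversal (mirror image) of $C(n,s)$. For a letter $c$ and a finite word $w$, $\gamma(cw)=wc$; $\gamma$ is a bijection on words of a given length, and $\gamma^k$ is defined for all $k\in\mathbb Z$. Let $u\in\{a,z\}^n$ and $v\in\{b,z\}^m$, let $A$ be the set of positions (indexed from $0$) of the letter $a$ in $u$ and $B$ the set of positions of the letter $b$ in $v$. The words $u,v$ are perfectly superimposable if $(A+n\mathbb Z)\cap(B+m\mathbb Z)=\emptyset$, and superimposable if there is $k\in\mathbb Z$ with $(A+n\mathbb Z)\cap(B-k+m\mathbb Z)=\emptyset$ (equivalently, $u$ and $\gamma^k(v)$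 are perfectly superimposable for some $k$). -}

module Defs where

open import Data.Bool.Base using (if_then_else_)
open import Data.Fin.Base using (Fin; toℕ)
open import Data.Integer.Base as ℤ using (ℤ; +_; -[1+_])
open import Data.Nat.Base using (ℕ; zero; suc; _*_; _∸_; NonZero)
open import Data.Nat.DivMod using (_%_)
open import Data.Nat.Properties using (_<?_)
open import Data.Product.Base using (∃-syntax; _×_; _,_)
open import Data.Vec.Base using (Vec; []; _∷_; _∷ʳ_; init; last; initLast; lookup; reverse; tabulate)
open import Data.Vec.Properties using (init-∷ʳ; last-∷ʳ)
open import Level using (0ℓ)
open import Relation.Binary.PropositionalEquality.Core using (_≡_; refl; cong₂)
open import Relation.Nullary.Decidable.Core using (does)
open import Relation.Unary using (Pred; _∩_; Empty)

-- The two ordered alphabets a < z and b < z.  They are separate types, so the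
-- letter z has one constructor in each.
data AZ : Set where
  a z : AZ

data BZ : Set where
  b z : BZ

-- C x y n s is the word C(n,s) over the ordered alphabet x < y, with t = n - s.
-- It is a Christoffel word only when s ≤ n and gcd n s ≡ 1; these are assumed
-- wherever it is used.  For n = s = 1 (so t = 0) the formula yields the word y,
-- not x.
C : {X : Set} → X → X → (n s : ℕ) → .{{NonZero n}} → Vec X n
C {X} x y n s = tabulate letter
  where
  t : ℕ
  t = n ∸ s

  letter : Fin n → X
  letter i = if does ((toℕ i * t) % n <? (suc (toℕ i) * t) % n) then x else y

C~ : {X : Set} → X → X → (n s : ℕ) → .{{NonZero n}} → Vec X n
C~ x y n s = reverse (C x y n s)

γ : {X : Set} {n : ℕ} → Vec X n → Vec X n
γ []      = []
γ (c ∷ w) = w ∷ʳ c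

γ⁻¹ : {X : Set} {n : ℕ} → Vec X n → Vec X n
γ⁻¹ {n = zero}  w = w
γ⁻¹ {n = suc _} w = last w ∷ init w

γ⁻¹-γ : {X : Set} {n : ℕ} (w : Vec X n) → γ⁻¹ (γ w) ≡ w
γ⁻¹-γ []      = refl
γ⁻¹-γ (c ∷ w) = cong₂ _∷_ (last-∷ʳ c w) (init-∷ʳ c w)

γ-γ⁻¹ : {X : Set} {n : ℕ} (w : Vec X n) → γ (γ⁻¹ w) ≡ w
γ-γ⁻¹ {n = zero}  []  = refl
γ-γ⁻¹ {n = suc _} w with initLast w
... | _ , _ , refl = refl

γ^ : ℤ → {X : Set} {n : ℕ} → Vec X n → Vec X n
γ^ (+ zero)     w = w
γ^ (+ suc k)    w = γ (γ^ (+ k) w)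
γ^ -[1+ zero  ] w = γ⁻¹ w
γ^ -[1+ suc k ] w = γ⁻¹ (γ^ -[1+ k ] w)

positions : {X : Set} {n : ℕ} → X → Vec X n → Pred ℤ 0ℓ
positions c w x = ∃[ i ] (lookup w i ≡ c × x ≡ + toℕ i)

infixl 6 _⊖_ _⊕_ℤ

_⊖_ : Pred ℤ 0ℓ → ℤ → Pred ℤ 0ℓ
(P ⊖ k) x = ∃[ p ] (P p × x ≡ p ℤ.- k)

-- P ⊕ n ℤ is the set P + nℤ.
_⊕_ℤ : Pred ℤ 0ℓ → ℕ → Pred ℤ 0ℓ
(P ⊕ n ℤ) x = ∃[ p ] ∃[ j ] (P p × x ≡ p ℤ.+ + n ℤ.* j)

PerfectlySuperimposable : {n m : ℕ} → Vec AZ n → Vec BZ m → Set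
PerfectlySuperimposable {n} {m} u v =
  Empty ((positions a u ⊕ n ℤ) ∩ (positions b v ⊕ m ℤ))

Superimposable : {n m : ℕ} → Vec AZ n → Vec BZ m → Set
Superimposable {n} {m} u v =
  ∃[ k ] Empty ((positions a u ⊕ n ℤ) ∩ ((positions b v ⊖ k) ⊕ m ℤ))

-- Modulo n > 1, the positions x of the small letter in C(n,s) are the solutions of
-- x s ≡ - j with 0 ≤ j < s.  Eliminating x, the conclusion says that
-- T = (2q - 1) α β is not congruent mod n to an element of the box
-- S = { j β + k α : 0 ≤ j < q α, 0 ≤ k < q β }, while superimposability says that S
-- misses some class Y mod n.  Let H = { j β + k α : j , k ≥ 0 }.  Each element of H
-- lies in S or in T + H, so each h ∈ H in the class Y satisfies h - T ∈ H.
-- Suppose σ ∈ S and σ ≡ T.  By coprimality T ∉ S, so σ = T ± d with d > 0 and n ∣ d.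
-- As both σ and 2T - σ lie in H, so does T - d, whence h - d = (h - T) + (T - d) is
-- again an element of H in the class Y: an infinite descent in ℕ.
module Submission where

open import Defs
open import Data.Bool.Base using (if_then_else_)
open import Data.Empty using (⊥)
open import Data.Fin.Base as Fin using (Fin; toℕ; fromℕ; fromℕ<; inject₁; opposite)
open import Data.Fin.Properties using (toℕ-fromℕ; toℕ-fromℕ<; toℕ-inject₁; toℕ<n; opposite-prop; opposite-involutive)
open import Data.Fin.Relation.Unary.Top using (view; ‵fromℕ; ‵inj₁)
open import Data.Nat.Base using (ℕ; zero; suc; NonZero; _+_; _*_; _∸_; _≤_; _<_; z≤n; s≤s; ≢-nonZero)
open import Data.Nat.Coprimality as Coprimality using (Coprime; gcd≡1⇒coprime; coprime-Bézout; coprime-divisor)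
open import Data.Nat.DivMod using (_%_; _/_; m%n<n; m≡m%n+[m/n]*n; %-distribˡ-+; m<n⇒m%n≡m; m≤n⇒[n∸m]%m≡n%m; n%1≡0)
import Data.Nat.Divisibility as ℕ
open import Data.Nat.GCD using (gcd; module Bézout)
import Data.Nat.Properties as ℕ
import Data.Nat.Tactic.RingSolver as ℕ-Ring
open import Data.Integer.Base as ℤ using (ℤ; +_; -[1+_]; 0ℤ; 1ℤ; ∣_∣)
open import Data.Integer.Divisibility using (_∣_)
open import Data.Integer.Divisibility.Signed
  using (divides; ∣ᵤ⇒∣; ∣⇒∣ᵤ; ∣m∣n⇒∣m+n; ∣m∣n⇒∣m-n; ∣n⇒∣m*n; ∣m⇒∣-m; ∣-refl)
  renaming (_∣_ to _∣ₛ_)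
open import Data.Integer.DivMod using (_%ℕ_; _/ℕ_; n%ℕd<d; a≡a%ℕn+[a/ℕn]*n)
import Data.Integer.Properties as ℤ
open import Data.Integer.Tactic.RingSolver using (solve-∀)
open import Data.Product.Base using (∃-syntax; _×_; _,_; proj₁; proj₂)
open import Data.Sum.Base using (_⊎_; inj₁; inj₂)
open import Data.Vec.Base using (Vec; []; _∷_; _∷ʳ_; initLast; lookup; reverse)
open import Data.Vec.Properties using (lookup∘tabulate; reverse-∷)
open import Relation.Binary.Definitions using (tri<; tri≈; tri>)
open import Relation.Binary.PropositionalEquality
  using (_≡_; _≢_; refl; sym; trans; cong; cong₂; subst; module ≡-Reasoning)
open import Relation.Nullary using (¬_; Dec; yes; no; does; contradiction)

private
  variable
    X : Set
    c d : X
    n : ℕ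
    x y : ℤ

∣-≡ : ∀ {k} → x ≡ y → k ∣ₛ x → k ∣ₛ y
∣-≡ = subst (_ ∣ₛ_)

0<gap : ∀ {i j k} → i < j → i + k ≡ j → 0 < k
0<gap {i} i<j refl = ℕ.+-cancelˡ-< i 0 _ (subst (_< i + _) (sym (ℕ.+-identityʳ i)) i<j)

-- The box inside the semigroup generated by α and β.

val : (α β j k : ℕ) → ℕ
val α β j k = j * β + k * α

-- With p = q - 1 as the parameter, q is positive and p + q is 2q - 1 without truncated subtraction.
module Box (p α β : ℕ) where

  q T : ℕ
  q = suc p
  T = (p + q) * (α * β)

  -- Trading α copies of β for β copies of α brings j below α. The new k then decides: below q β the
  -- pair is in the box; below (2q - 1) β trading back p times puts it there; otherwise T splits
  -- off.
  reduce : .{{_ : NonZero α}} → ∀ j k →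
    (∃[ j′ ] ∃[ k′ ] (j′ < q * α × k′ < q * β × val α β j′ k′ ≡ val α β j k)) ⊎
    (∃[ j′ ] ∃[ k′ ] val α β j′ k′ + T ≡ val α β j k)
  reduce j k = go (K ℕ.<? q * β)
    where
    j₀ j₁ K : ℕ
    j₀ = j % α
    j₁ = j / α
    K = k + j₁ * β

    val₀ : val α β j₀ K ≡ val α β j k
    val₀ = trans (lem j₀ j₁ k α β) (cong (λ i → val α β i k) (sym (m≡m%n+[m/n]*n j α)))
      where
      lem : ∀ j₀ j₁ k α β → j₀ * β + (k + j₁ * β) * α ≡ (j₀ + j₁ * α) * β + k * α
      lem = ℕ-Ring.solve-∀

    j₀<α : j₀ < α
    j₀<α = m%n<n j α

    go : Dec (K < q * β) → _
    go (yes K<) = inj₁ (j₀ , K , ℕ.<-≤-trans j₀<α (ℕ.m≤m+n α (p * α)) , K< , val₀)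
    go (no K≮) with ℕ.m≤n⇒∃[o]m+o≡n (ℕ.≮⇒≥ K≮)
    ... | e , qβ+e≡K with e ℕ.<? p * β
    ...   | yes e< = inj₁ (j₀ + p * α , β + e , ℕ.+-monoˡ-< (p * α) j₀<α , ℕ.+-monoʳ-< β e< ,
              trans (lem j₀ e p α β) (trans (cong (val α β j₀) qβ+e≡K) val₀))
      where
      lem : ∀ j₀ e p α β → (j₀ + p * α) * β + (β + e) * α ≡ j₀ * β + ((β + p * β) + e) * α
      lem = ℕ-Ring.solve-∀
    ...   | no e≮ with ℕ.m≤n⇒∃[o]m+o≡n (ℕ.≮⇒≥ e≮)
    ...     | e′ , refl = inj₂ (j₀ , e′ ,
                trans (lem j₀ e′ p α β) (trans (cong (val α β j₀) qβ+e≡K) val₀))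
      where
      lem : ∀ j₀ e p α β → j₀ * β + e * α + (p + (1 + p)) * (α * β) ≡
                           j₀ * β + ((β + p * β) + (p * β + e)) * α
      lem = ℕ-Ring.solve-∀

  q*≤[p+q]* : ∀ s → q * s ≤ (p + q) * s
  q*≤[p+q]* s = ℕ.*-monoˡ-≤ s (ℕ.m≤n+m q p)

  -- Reflection in T: since q ≤ 2q - 1, the coefficients (2q - 1) α - j and (2q - 1) β - k are
  -- natural numbers.
  complement : ∀ {j k} → j < q * α → k < q * β →
    ∃[ j′ ] ∃[ k′ ] val α β j′ k′ + val α β j k ≡ T + T
  complement {j} {k} j< k<
    with ℕ.m≤n⇒∃[o]m+o≡n (ℕ.≤-trans (ℕ.<⇒≤ j<) (q*≤[p+q]* α))
       | ℕ.m≤n⇒∃[o]m+o≡n (ℕ.≤-trans (ℕ.<⇒≤ k<) (q*≤[p+q]* β))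
  ... | j′ , j+j′≡ | k′ , k+k′≡ = j′ , k′ , (begin
    val α β j′ k′ + val α β j k                ≡⟨ lem₁ j j′ k k′ α β ⟩
    (j + j′) * β + (k + k′) * α                ≡⟨ cong₂ (val α β) j+j′≡ k+k′≡ ⟩
    val α β ((p + q) * α) ((p + q) * β)        ≡⟨ lem₂ (p + q) α β ⟩
    T + T                                      ∎)
    where
    open ≡-Reasoning
    lem₁ : ∀ j j′ k k′ α β → j′ * β + k′ * α + (j * β + k * α) ≡ (j + j′) * β + (k + k′) * α
    lem₁ = ℕ-Ring.solve-∀
    lem₂ : ∀ s α β → (s * α) * β + (s * β) * α ≡ s * (α * β) + s * (α * β)
    lem₂ = ℕ-Ring.solve-∀

  -- Reducing an equality modulo α and modulo β, coprimality forces α ∣ j and β ∣ k. Cancelling α β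
  -- leaves j′ + k′ = 2q - 1, although j′ and k′ are at most q - 1.
  val≢T : Coprime α β → ∀ {j k} → j < q * α → k < q * β → val α β j k ≢ T
  val≢T cop {j} {k} j< k< eq with α∣j | β∣k
    where
    α∣T : α ℕ.∣ T
    α∣T = ℕ.∣n⇒∣m*n (p + q) (ℕ.m∣m*n β)
    β∣T : β ℕ.∣ T
    β∣T = ℕ.∣n⇒∣m*n (p + q) (ℕ.n∣m*n α)
    α∣j : α ℕ.∣ j
    α∣j = coprime-divisor cop (subst (α ℕ.∣_) (ℕ.*-comm j β)
            (ℕ.∣m+n∣m⇒∣n (subst (α ℕ.∣_) (trans (sym eq) (ℕ.+-comm (j * β) (k * α))) α∣T) (ℕ.n∣m*n k)))
    β∣k : β ℕ.∣ k
    β∣k = coprime-divisor (Coprimality.sym cop) (subst (β ℕ.∣_) (ℕ.*-comm k α)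
            (ℕ.∣m+n∣m⇒∣n (subst (β ℕ.∣_) (sym eq) β∣T) (ℕ.n∣m*n j)))
  ... | ℕ.divides j′ refl | ℕ.divides k′ refl = ℕ.<-irrefl j′+k′≡p+q j′+k′<p+q
    where
    j′≤p : j′ ≤ p
    j′≤p = ℕ.≤-pred (ℕ.*-cancelʳ-< α j′ q j<)
    k′<q : k′ < q
    k′<q = ℕ.*-cancelʳ-< β k′ q k<
    j′+k′<p+q : j′ + k′ < p + q
    j′+k′<p+q = ℕ.+-mono-≤-< j′≤p k′<q
    -- A zero α or β would leave no room for `j<` or `k<`.
    instance
      _ : NonZero α
      _ = ≢-nonZero λ { refl → ℕ.n≮0 (subst (j′ * 0 <_) (ℕ.*-zeroʳ q) j<) }
      _ : NonZero β
      _ = ≢-nonZero λ { refl → ℕ.n≮0 (subst (k′ * 0 <_) (ℕ.*-zeroʳ q) k<) }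
      _ : NonZero (α * β)
      _ = ℕ.m*n≢0 α β
    lem : ∀ j k α β → j * α * β + k * β * α ≡ (j + k) * (α * β)
    lem = ℕ-Ring.solve-∀
    j′+k′≡p+q : j′ + k′ ≡ p + q
    j′+k′≡p+q = ℕ.*-cancelʳ-≡ _ _ (α * β) (trans (sym (lem j′ k′ α β)) eq)

  module _ (n : ℕ) (Y : ℤ)
    (missed : ∀ {j k} → j < q * α → k < q * β → ¬ + n ∣ₛ + val α β j k ℤ.- Y) where

    -- By `missed`, `reduce` cannot land in the box, so T splits off. Putting `val α β u v`, which
    -- is T - d, in its place lowers the element by a multiple of n and keeps it in the class of Y.
    -- The bound N makes the recursion structural.
    descent : .{{_ : NonZero α}} → ∀ {d} → 0 < d → + n ∣ₛ + d →
      ∀ u v → val α β u v + d ≡ T →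
      ∀ N j k → val α β j k < N → ¬ + n ∣ₛ + val α β j k ℤ.- Y
    descent {d} 0<d n∣d u v eq (suc N) j k (s≤s val≤N) n∣ with reduce j k
    ... | inj₁ (j′ , k′ , j< , k< , val≡) =
      missed j< k< (subst (λ w → + n ∣ₛ + w ℤ.- Y) (sym val≡) n∣)
    ... | inj₂ (j′ , k′ , val≡) = descent 0<d n∣d u v eq N (j′ + u) (k′ + v) smaller
      (∣-≡ congr (∣m∣n⇒∣m-n n∣ n∣d))
      where
      lem : ∀ j k u v α β d →
        (j + u) * β + (k + v) * α + d ≡ j * β + k * α + (u * β + v * α + d)
      lem = ℕ-Ring.solve-∀
      shifted : val α β (j′ + u) (k′ + v) + d ≡ val α β j k
      shifted = trans (lem j′ k′ u v α β d) (trans (cong (_+_ (val α β j′ k′)) eq) val≡)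
      smaller : val α β (j′ + u) (k′ + v) < N
      smaller = ℕ.<-≤-trans (ℕ.m<m+n _ 0<d) (ℕ.≤-trans (ℕ.≤-reflexive shifted) val≤N)
      lemℤ : ∀ w d Y → (w ℤ.+ d) ℤ.- Y ℤ.- d ≡ w ℤ.- Y
      lemℤ = solve-∀
      congr : + val α β j k ℤ.- Y ℤ.- + d ≡ + val α β (j′ + u) (k′ + v) ℤ.- Y
      congr = trans (cong (λ w → + w ℤ.- Y ℤ.- + d) (sym shifted)) (lemℤ (+ val α β (j′ + u) (k′ + v)) (+ d) Y)

    T-unattained : .{{_ : NonZero α}} → Coprime α β →
      ∀ j₀ k₀ → + n ∣ₛ + val α β j₀ k₀ ℤ.- Y →
      ∀ {j k} → j < q * α → k < q * β → ¬ + n ∣ₛ + val α β j k ℤ.- + T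
    T-unattained cop j₀ k₀ start {j} {k} j< k< n∣ with ℕ.<-cmp (val α β j k) T
    ... | tri≈ _ eq _ = val≢T cop j< k< eq
    -- Below T, the box element is itself the T - d that the descent needs.
    ... | tri< val<T _ _ with ℕ.m≤n⇒∃[o]m+o≡n (ℕ.<⇒≤ val<T)
    ...   | d , eq = descent 0<d n∣d j k eq (suc _) j₀ k₀ ℕ.≤-refl start
      where
      0<d : 0 < d
      0<d = 0<gap val<T eq
      lem : ∀ w d → ℤ.- (w ℤ.- (w ℤ.+ d)) ≡ d
      lem = solve-∀
      n∣d : + n ∣ₛ + d
      n∣d = ∣-≡ (trans (cong (λ w → ℤ.- (+ val α β j k ℤ.- + w)) (sym eq)) (lem (+ val α β j k) (+ d)))
              (∣m⇒∣-m n∣)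
    -- Above T, the box element is T + d, and its reflection 2T - (T + d) is T - d.
    T-unattained cop j₀ k₀ start {j} {k} j< k< n∣ | tri> _ _ T<val
      with ℕ.m≤n⇒∃[o]m+o≡n (ℕ.<⇒≤ T<val) | complement j< k<
    ...   | d , eq | j′ , k′ , eq′ =
      descent 0<d n∣d j′ k′ (ℕ.+-cancelʳ-≡ T _ _ below) (suc _) j₀ k₀ ℕ.≤-refl start
      where
      0<d : 0 < d
      0<d = 0<gap T<val eq
      lem : ∀ w d → (w ℤ.+ d) ℤ.- w ≡ d
      lem = solve-∀
      n∣d : + n ∣ₛ + d
      n∣d = ∣-≡ (trans (cong (λ w → + w ℤ.- + T) (sym eq)) (lem (+ T) (+ d))) n∣
      lem′ : ∀ w d T → w + d + T ≡ w + (T + d)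
      lem′ = ℕ-Ring.solve-∀
      below : val α β j′ k′ + d + T ≡ T + T
      below = trans (lem′ (val α β j′ k′) d T) (trans (cong (_+_ (val α β j′ k′)) eq) eq′)

-- Periodic positions of a letter

Occurs : X → Vec X n → ℤ → Set
Occurs {n = n} c w = positions c w ⊕ n ℤ

-- With membership in P + nℤ put as a divisibility, moving an occurrence along `γ`, `γ⁻¹` or
-- `reverse` comes down to a ring identity.
occurs : ∀ (w : Vec X n) i → lookup w i ≡ c → + n ∣ₛ x ℤ.- + toℕ i → Occurs c w x
occurs {n = n} {x = x} w i eq (divides k x-i≡) =
  + toℕ i , k , (i , eq , refl) , (begin
    x                                  ≡⟨ lem x (+ toℕ i) ⟩
    + toℕ i ℤ.+ (x ℤ.- + toℕ i)        ≡⟨ cong (λ m → + toℕ i ℤ.+ m) (trans x-i≡ (ℤ.*-comm k (+ n))) ⟩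
    + toℕ i ℤ.+ + n ℤ.* k              ∎)
  where
  open ≡-Reasoning
  lem : ∀ x i → x ≡ i ℤ.+ (x ℤ.- i)
  lem = solve-∀

occurs⁻¹ : ∀ (w : Vec X n) → Occurs c w x → ∃[ i ] (lookup w i ≡ c × + n ∣ₛ x ℤ.- + toℕ i)
occurs⁻¹ {n = n} w (_ , k , (i , eq , refl) , refl) = i , eq , divides k (lem (+ toℕ i) (+ n) k)
  where
  lem : ∀ i n k → i ℤ.+ n ℤ.* k ℤ.- i ≡ k ℤ.* n
  lem = solve-∀

occurs-⊖ : ∀ k (w : Vec X n) → Occurs c w (x ℤ.+ k) → ((positions c w ⊖ k) ⊕ n ℤ) x
occurs-⊖ {n = n} {x = x} k w (i , m , i∈w , x+k≡) = i ℤ.- k , m , (i , i∈w , refl) , (begin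
  x                             ≡⟨ lem₁ x k ⟩
  x ℤ.+ k ℤ.- k                 ≡⟨ cong (ℤ._- k) x+k≡ ⟩
  i ℤ.+ + n ℤ.* m ℤ.- k         ≡⟨ lem₂ i (+ n ℤ.* m) k ⟩
  i ℤ.- k ℤ.+ + n ℤ.* m         ∎)
  where
  open ≡-Reasoning
  lem₁ : ∀ x k → x ≡ x ℤ.+ k ℤ.- k
  lem₁ = solve-∀
  lem₂ : ∀ i m k → i ℤ.+ m ℤ.- k ≡ i ℤ.- k ℤ.+ m
  lem₂ = solve-∀

lookup-∷ʳ-fromℕ : ∀ (w : Vec X n) (d : X) → lookup (w ∷ʳ d) (fromℕ n) ≡ d
lookup-∷ʳ-fromℕ []      d = refl
lookup-∷ʳ-fromℕ (_ ∷ w) d = lookup-∷ʳ-fromℕ w d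

lookup-∷ʳ-inject₁ : ∀ (w : Vec X n) (d : X) i → lookup (w ∷ʳ d) (inject₁ i) ≡ lookup w i
lookup-∷ʳ-inject₁ (_ ∷ w) d Fin.zero    = refl
lookup-∷ʳ-inject₁ (_ ∷ w) d (Fin.suc i) = lookup-∷ʳ-inject₁ w d i

lookup-reverse : ∀ (w : Vec X n) i → lookup (reverse w) (opposite i) ≡ lookup w i
lookup-reverse (d ∷ w) Fin.zero rewrite reverse-∷ d w = lookup-∷ʳ-fromℕ (reverse w) d
lookup-reverse (d ∷ w) (Fin.suc i) rewrite reverse-∷ d w =
  trans (lookup-∷ʳ-inject₁ (reverse w) d (opposite i)) (lookup-reverse w i)

occurs-γ : ∀ (w : Vec X n) → Occurs c (γ w) x → Occurs c w (x ℤ.+ 1ℤ)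
occurs-γ {n = suc n} {x = x} (d ∷ w) o with occurs⁻¹ (w ∷ʳ d) o
... | i , eq , n∣ with view i
-- The last letter of `γ (d ∷ w)` is the first of `d ∷ w`, so a full period is added to the
-- difference.
...   | ‵fromℕ = occurs (d ∷ w) Fin.zero (trans (sym (lookup-∷ʳ-fromℕ w d)) eq)
          (∣-≡ (trans (cong (λ k → x ℤ.- + k ℤ.+ + suc n) (toℕ-fromℕ n)) (lem x (+ n)))
            (∣m∣n⇒∣m+n n∣ ∣-refl))
  where
  lem : ∀ x n → x ℤ.- n ℤ.+ (1ℤ ℤ.+ n) ≡ x ℤ.+ 1ℤ ℤ.- 0ℤ
  lem = solve-∀
...   | ‵inj₁ {i = i′} _ = occurs (d ∷ w) (Fin.suc i′) (trans (sym (lookup-∷ʳ-inject₁ w d i′)) eq)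
          (∣-≡ (trans (cong (λ k → x ℤ.- + k) (toℕ-inject₁ i′)) (lem x (+ toℕ i′))) n∣)
  where
  lem : ∀ x i → x ℤ.- i ≡ x ℤ.+ 1ℤ ℤ.- (1ℤ ℤ.+ i)
  lem = solve-∀

occurs-γ⁻¹ : ∀ (w : Vec X n) → Occurs c (γ⁻¹ w) x → Occurs c w (x ℤ.- 1ℤ)
occurs-γ⁻¹ {n = zero} [] (_ , _ , (() , _) , _)
occurs-γ⁻¹ {n = suc n} {x = x} w o with initLast w | occurs⁻¹ (γ⁻¹ w) o
... | w′ , d , refl | Fin.zero , eq , n∣ =
  occurs (w′ ∷ʳ d) (fromℕ n) (trans (lookup-∷ʳ-fromℕ w′ d) eq)
    (∣-≡ (trans (lem x (+ n)) (cong (λ k → x ℤ.- 1ℤ ℤ.- + k) (sym (toℕ-fromℕ n)))) (∣m∣n⇒∣m-n n∣ ∣-refl))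
  where
  lem : ∀ x n → x ℤ.- 0ℤ ℤ.- (1ℤ ℤ.+ n) ≡ x ℤ.- 1ℤ ℤ.- n
  lem = solve-∀
... | w′ , d , refl | Fin.suc i , eq , n∣ =
  occurs (w′ ∷ʳ d) (inject₁ i) (trans (lookup-∷ʳ-inject₁ w′ d i) eq)
    (∣-≡ (trans (lem x (+ toℕ i)) (cong (λ k → x ℤ.- 1ℤ ℤ.- + k) (sym (toℕ-inject₁ i)))) n∣)
  where
  lem : ∀ x i → x ℤ.- (1ℤ ℤ.+ i) ≡ x ℤ.- 1ℤ ℤ.- i
  lem = solve-∀

occurs-γ^ : ∀ k (w : Vec X n) → Occurs c (γ^ k w) x → Occurs c w (x ℤ.+ k)
occurs-γ^ {c = c} {x} (+ zero) w o = subst (Occurs c w) (sym (ℤ.+-identityʳ x)) o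
occurs-γ^ {c = c} {x} (+ suc k) w o =
  subst (Occurs c w) (ℤ.+-assoc x 1ℤ (+ k)) (occurs-γ^ (+ k) w (occurs-γ (γ^ (+ k) w) o))
occurs-γ^ -[1+ zero ] w o = occurs-γ⁻¹ w o
occurs-γ^ {c = c} {x} -[1+ suc k ] w o =
  subst (Occurs c w) (ℤ.+-assoc x (ℤ.- 1ℤ) -[1+ k ])
    (occurs-γ^ -[1+ k ] w (occurs-γ⁻¹ (γ^ -[1+ k ] w) o))

-- Reversal sends i to n - 1 - i, which is -1 - i modulo n.
occurs-reverse : ∀ (w : Vec X n) → Occurs c (reverse w) x → Occurs c w (ℤ.- 1ℤ ℤ.- x)
occurs-reverse {n = n} {x = x} w o with occurs⁻¹ (reverse w) o
... | i , eq , n∣ = occurs w (opposite i)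
  (trans (sym (lookup-reverse w (opposite i))) (trans (cong (lookup (reverse w)) (opposite-involutive i)) eq))
  (∣-≡ (trans (lem x (+ toℕ i) (+ toℕ (opposite i)))
         (trans (cong (λ k → ℤ.- 1ℤ ℤ.- x ℤ.- + toℕ (opposite i) ℤ.+ (k ℤ.- + n)) sum) (lem′ _ (+ n))))
    (∣m⇒∣-m (∣m∣n⇒∣m+n n∣ (∣-refl {+ n}))))
  where
  sum : + toℕ (opposite i) ℤ.+ (1ℤ ℤ.+ + toℕ i) ≡ + n
  sum = cong +_ (trans (cong (_+ suc (toℕ i)) (opposite-prop i)) (ℕ.m∸n+n≡m (toℕ<n i)))
  lem : ∀ x i o → ℤ.- (x ℤ.- i ℤ.+ + n) ≡
    ℤ.- 1ℤ ℤ.- x ℤ.- o ℤ.+ ((o ℤ.+ (1ℤ ℤ.+ i)) ℤ.- + n)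
  lem x i o = ring x i o (+ n)
    where
    ring : ∀ x i o n → ℤ.- (x ℤ.- i ℤ.+ n) ≡
      ℤ.- 1ℤ ℤ.- x ℤ.- o ℤ.+ ((o ℤ.+ (1ℤ ℤ.+ i)) ℤ.- n)
    ring = solve-∀
  lem′ : ∀ y n → y ℤ.+ (n ℤ.- n) ≡ y
  lem′ = solve-∀

-- Positions of the small letter in a Christoffel word

if-≡⇒ : ∀ {P : Set} {c d : X} (p? : Dec P) → c ≢ d → (if does p? then c else d) ≡ c → P
if-≡⇒ (yes p) _   _  = p
if-≡⇒ (no _)  c≢d eq = contradiction (sym eq) c≢d

if-≡⇐ : ∀ {P : Set} {c d : X} (p? : Dec P) → P → (if does p? then c else d) ≡ c
if-≡⇐ (yes _) _ = refl
if-≡⇐ (no ¬p) p = contradiction p ¬p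

module _ {c d : X} {n s : ℕ} .{{_ : NonZero n}} where

  lookup-C⇒ : c ≢ d → ∀ i → lookup (C c d n s) i ≡ c →
    (toℕ i * (n ∸ s)) % n < (suc (toℕ i) * (n ∸ s)) % n
  lookup-C⇒ c≢d i eq = if-≡⇒ (_ ℕ.<? _) c≢d (trans (sym (lookup∘tabulate _ i)) eq)

  lookup-C⇐ : ∀ i → (toℕ i * (n ∸ s)) % n < (suc (toℕ i) * (n ∸ s)) % n →
    lookup (C c d n s) i ≡ c
  lookup-C⇐ i lt = trans (lookup∘tabulate _ i) (if-≡⇐ (_ ℕ.<? _) lt)

step-% : ∀ {n t} .{{_ : NonZero n}} → t < n → ∀ k → (t + k) % n ≡ (t + k % n) % n
step-% {n} {t} t<n k = trans (%-distribˡ-+ t k n) (cong (λ z → (z + k % n) % n) (m<n⇒m%n≡m t<n))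

-- For k = i t with t = n - s, the residues of i t and (i + 1) t are compared. Adding t carries a
-- residue of at least s past n, and it comes back lowered by s.
ascent⇒ : ∀ {n s} .{{_ : NonZero n}} → 0 < s → s ≤ n → ∀ k →
  k % n < (n ∸ s + k) % n → k % n < s
ascent⇒ {n} {s} 0<s s≤n k lt = ℕ.≰⇒> λ s≤k%n → ℕ.<⇒≱ lt (drop s≤k%n)
  where
  t = n ∸ s
  t<n : t < n
  t<n = ℕ.∸-monoʳ-< 0<s s≤n
  drop : s ≤ k % n → (t + k) % n ≤ k % n
  drop s≤k%n = begin
    (t + k) % n              ≡⟨ step-% t<n k ⟩
    (t + k % n) % n          ≡⟨ m≤n⇒[n∸m]%m≡n%m n≤t+k%n ⟨
    (t + k % n ∸ n) % n      ≡⟨ m<n⇒m%n≡m (ℕ.≤-<-trans t+k%n∸n≤k%n (m%n<n k n)) ⟩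
    t + k % n ∸ n            ≤⟨ t+k%n∸n≤k%n ⟩
    k % n                    ∎
    where
    open ℕ.≤-Reasoning
    n≤t+k%n : n ≤ t + k % n
    n≤t+k%n = ℕ.≤-trans (ℕ.≤-reflexive (sym (ℕ.m∸n+n≡m s≤n))) (ℕ.+-monoʳ-≤ t s≤k%n)
    t+k%n∸n≤k%n : t + k % n ∸ n ≤ k % n
    t+k%n∸n≤k%n = ℕ.m≤n+o⇒m∸n≤o (t + k % n) n (ℕ.+-monoˡ-≤ (k % n) (ℕ.<⇒≤ t<n))

-- A residue below s stays below n when t is added: nothing wraps, and it grows by t > 0.
ascent⇐ : ∀ {n s} .{{_ : NonZero n}} → s < n → ∀ k →
  k % n < s → k % n < (n ∸ s + k) % n
ascent⇐ {n} {s} s<n k k%n<s = subst (k % n <_) (sym eq) (ℕ.m<n+m (k % n) (ℕ.m<n⇒0<n∸m s<n))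
  where
  t = n ∸ s
  eq : (t + k) % n ≡ t + k % n
  eq = trans (step-% (ℕ.∸-monoʳ-< (ℕ.≤-<-trans z≤n k%n<s) (ℕ.<⇒≤ s<n)) k)
    (m<n⇒m%n≡m (ℕ.<-≤-trans (ℕ.+-monoʳ-< t k%n<s) (ℕ.≤-reflexive (ℕ.m∸n+n≡m (ℕ.<⇒≤ s<n)))))

∣-<⇒≡ : ∀ {i j} → i < n → j < n → + n ∣ₛ + i ℤ.- + j → i ≡ j
∣-<⇒≡ {n} {i} {j} i<n j<n n∣ = ℤ.+-injective (ℤ.i-j≡0⇒i≡j (+ i) (+ j) (ℤ.∣i∣≡0⇒i≡0 (zero-of (∣ + i ℤ.- + j ∣) bound (∣⇒∣ᵤ n∣))))
  where
  bound : ∣ + i ℤ.- + j ∣ < n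
  bound = ℕ.≤-<-trans (ℕ.≤-trans (ℕ.≤-reflexive (cong ∣_∣ (ℤ.[+m]-[+n]≡m⊖n i j))) (ℤ.∣m⊝n∣≤m⊔n i j))
            (ℕ.⊔-lub i<n j<n)
  zero-of : ∀ k → k < n → n ℕ.∣ k → k ≡ 0
  zero-of zero    _   _   = refl
  zero-of (suc k) k<n n∣k = contradiction n∣k (ℕ.>⇒∤ k<n)

-- As t = n - s is -s modulo n, the congruence makes j the class of x t, the quantity compared in
-- the definition of a Christoffel word.
Residual : (n s : ℕ) → ℤ → Set
Residual n s x = ∃[ j ] (j < s × + n ∣ₛ x ℤ.* + s ℤ.+ + j)

module _ {X : Set} {c d : X} {n s : ℕ} .{{_ : NonZero n}} (s≤n : s ≤ n) (gcd≡1 : gcd n s ≡ 1) (n≢1 : n ≢ 1) where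

  private
    t : ℕ
    t = n ∸ s

    cop : Coprime n s
    cop = gcd≡1⇒coprime gcd≡1

    -- If s were n or, for `0<s`, if s were 0, then n would be a common divisor of n and s, whence n
    -- = 1.
    s<n : s < n
    s<n = ℕ.≤∧≢⇒< s≤n λ { refl → n≢1 (cop (ℕ.∣-refl , ℕ.∣-refl)) }

    0<s : 0 < s
    0<s = ℕ.≤∧≢⇒< z≤n λ { refl → n≢1 (cop (ℕ.∣-refl , (n ℕ.∣0))) }

    -- From x ≡ i follows x s + i t ≡ i (s + t) = i n ≡ 0, and i t may be replaced by its remainder.
    residue : ∀ i → + n ∣ₛ x ℤ.- + i → + n ∣ₛ x ℤ.* + s ℤ.+ + ((i * t) % n)
    residue {x} i n∣ = ∣-≡ eq
      (∣m∣n⇒∣m+n (∣n⇒∣m*n (+ s) n∣) (∣n⇒∣m*n (+ i ℤ.- + w) (∣-refl {+ n})))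
      where
      j w : ℕ
      j = (i * t) % n
      w = (i * t) / n
      it≡ : + i ℤ.* + t ≡ + j ℤ.+ + w ℤ.* + n
      it≡ = trans (sym (ℤ.pos-* i t))
              (trans (cong +_ (m≡m%n+[m/n]*n (i * t) n)) (cong (λ m → + j ℤ.+ m) (ℤ.pos-* w n)))
      n≡ : + n ≡ + t ℤ.+ + s
      n≡ = cong +_ (sym (ℕ.m∸n+n≡m s≤n))
      lem₁ : ∀ s x i w n → s ℤ.* (x ℤ.- i) ℤ.+ (i ℤ.- w) ℤ.* n ≡
        x ℤ.* s ℤ.- i ℤ.* s ℤ.+ i ℤ.* n ℤ.- w ℤ.* n
      lem₁ = solve-∀
      lem₂ : ∀ s x i w t n → x ℤ.* s ℤ.- i ℤ.* s ℤ.+ i ℤ.* (t ℤ.+ s) ℤ.- w ℤ.* n ≡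
        x ℤ.* s ℤ.+ (i ℤ.* t) ℤ.- w ℤ.* n
      lem₂ = solve-∀
      lem₃ : ∀ a j w → a ℤ.+ (j ℤ.+ w) ℤ.- w ≡ a ℤ.+ j
      lem₃ = solve-∀
      eq : + s ℤ.* (x ℤ.- + i) ℤ.+ (+ i ℤ.- + w) ℤ.* + n ≡ x ℤ.* + s ℤ.+ + j
      eq = begin
        + s ℤ.* (x ℤ.- + i) ℤ.+ (+ i ℤ.- + w) ℤ.* + n
          ≡⟨ lem₁ (+ s) x (+ i) (+ w) (+ n) ⟩
        x ℤ.* + s ℤ.- + i ℤ.* + s ℤ.+ + i ℤ.* + n ℤ.- + w ℤ.* + n
          ≡⟨ cong (λ m → x ℤ.* + s ℤ.- + i ℤ.* + s ℤ.+ + i ℤ.* m ℤ.- + w ℤ.* + n) n≡ ⟩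
        x ℤ.* + s ℤ.- + i ℤ.* + s ℤ.+ + i ℤ.* (+ t ℤ.+ + s) ℤ.- + w ℤ.* + n
          ≡⟨ lem₂ (+ s) x (+ i) (+ w) (+ t) (+ n) ⟩
        x ℤ.* + s ℤ.+ (+ i ℤ.* + t) ℤ.- + w ℤ.* + n
          ≡⟨ cong (λ m → x ℤ.* + s ℤ.+ m ℤ.- + w ℤ.* + n) it≡ ⟩
        x ℤ.* + s ℤ.+ (+ j ℤ.+ + w ℤ.* + n) ℤ.- + w ℤ.* + n
          ≡⟨ lem₃ (x ℤ.* + s) (+ j) (+ w ℤ.* + n) ⟩
        x ℤ.* + s ℤ.+ + j ∎
        where open ≡-Reasoning

  occurs-C⇒ : c ≢ d → Occurs c (C c d n s) x → Residual n s x
  occurs-C⇒ {x} c≢d o with occurs⁻¹ (C c d n s) o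
  ... | i , eq , n∣ =
    (toℕ i * t) % n , ascent⇒ 0<s s≤n (toℕ i * t) (lookup-C⇒ {n = n} {s} c≢d i eq) , residue {x} (toℕ i) n∣

  occurs-C⇐ : Residual n s x → Occurs c (C c d n s) x
  occurs-C⇐ {x} (j , j<s , n∣) = occurs (C c d n s) (fromℕ< i<n)
    (lookup-C⇐ {n = n} {s} (fromℕ< i<n) (subst (λ i → (i * t) % n < (suc i * t) % n) (sym (toℕ-fromℕ< i<n))
      (ascent⇐ s<n (i * t) (subst (_< s) (sym j′≡j) j<s))))
    (subst (λ i → + n ∣ₛ x ℤ.- + i) (sym (toℕ-fromℕ< i<n)) n∣x-i)
    where
    i : ℕ
    i = x %ℕ n
    i<n : i < n
    i<n = n%ℕd<d x n
    lem : ∀ i k n → i ℤ.+ k ℤ.* n ℤ.- i ≡ k ℤ.* n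
    lem = solve-∀
    n∣x-i : + n ∣ₛ x ℤ.- + i
    n∣x-i = divides (x /ℕ n) (trans (cong (ℤ._- + i) (a≡a%ℕn+[a/ℕn]*n x n)) (lem (+ i) (x /ℕ n) (+ n)))
    lem′ : ∀ a j j′ → (a ℤ.+ j′) ℤ.- (a ℤ.+ j) ≡ j′ ℤ.- j
    lem′ = solve-∀
    -- Both are congruent to - x s and lie below n, so the bound j < s passes to the residue at
    -- position i.
    j′≡j : (i * t) % n ≡ j
    j′≡j = ∣-<⇒≡ (m%n<n (i * t) n) (ℕ.<-trans j<s s<n)
      (∣-≡ (lem′ (x ℤ.* + s) (+ j) (+ ((i * t) % n))) (∣m∣n⇒∣m-n (residue {x} i n∣x-i) n∣))

inverse : ∀ {n s} → Coprime n s → ∃[ u ] + n ∣ₛ u ℤ.* + s ℤ.- 1ℤ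
inverse {n} {s} cop with coprime-Bézout cop
... | Bézout.+- x y eq = ℤ.- + y , divides (ℤ.- + x) (begin
  (ℤ.- + y) ℤ.* + s ℤ.- 1ℤ       ≡⟨ lem (+ y) (+ s) ⟩
  ℤ.- (1ℤ ℤ.+ + y ℤ.* + s)       ≡⟨ cong (λ m → ℤ.- (1ℤ ℤ.+ m)) (ℤ.pos-* y s) ⟨
  ℤ.- + (1 + y * s)              ≡⟨ cong (λ m → ℤ.- + m) eq ⟩
  ℤ.- + (x * n)                  ≡⟨ cong ℤ.-_ (ℤ.pos-* x n) ⟩
  ℤ.- (+ x ℤ.* + n)              ≡⟨ ℤ.neg-distribˡ-* (+ x) (+ n) ⟩
  (ℤ.- + x) ℤ.* + n              ∎)
  where
  open ≡-Reasoning
  lem : ∀ y s → (ℤ.- y) ℤ.* s ℤ.- 1ℤ ≡ ℤ.- (1ℤ ℤ.+ y ℤ.* s)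
  lem = solve-∀
... | Bézout.-+ x y eq = + y , divides (+ x) (begin
  + y ℤ.* + s ℤ.- 1ℤ       ≡⟨ cong (ℤ._- 1ℤ) (ℤ.pos-* y s) ⟨
  + (y * s) ℤ.- 1ℤ         ≡⟨ cong (λ m → + m ℤ.- 1ℤ) eq ⟨
  1ℤ ℤ.+ + (x * n) ℤ.- 1ℤ  ≡⟨ lem (+ (x * n)) ⟩
  + (x * n)                ≡⟨ ℤ.pos-* x n ⟩
  + x ℤ.* + n              ∎)
  where
  open ≡-Reasoning
  lem : ∀ m → 1ℤ ℤ.+ m ℤ.- 1ℤ ≡ m
  lem = solve-∀

-- All residues modulo 1 are 0, so there is no ascent. This settles n = 1, where 0 < s < n is
-- impossible.
C-1-empty : ∀ {c d : X} s → c ≢ d → ¬ Occurs c (C c d 1 s) x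
C-1-empty {c = c} {d} s c≢d o with occurs⁻¹ (C c d 1 s) o
... | i , eq , _ with lookup-C⇒ {c = c} {d} {1} {s} c≢d i eq
...   | lt rewrite n%1≡0 (toℕ i * (1 ∸ s)) | n%1≡0 (suc (toℕ i) * (1 ∸ s)) = ℕ.n≮0 lt

-- From superimposability to congruences in the box.

pos-val : ∀ α β j k → + val α β j k ≡ + j ℤ.* + β ℤ.+ + k ℤ.* + α
pos-val α β j k = cong₂ ℤ._+_ (ℤ.pos-* j β) (ℤ.pos-* k α)

-- Position x of u meets position x + K of v when x q α ≡ - j and
-- (x + K) q β ≡ - (q β - 1 - k) mod n for some (j , k) in the box; eliminating x
-- shows that then j β + k α lies in this class.
missedClass : (q α β : ℕ) → ℤ → ℤ
missedClass q α β K = (K ℤ.* + (q * β) ℤ.+ (+ (q * β) ℤ.- 1ℤ)) ℤ.* + α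

-- The class is a multiple Y₀ α, so a natural representative k of Y₀ gives an element k α of the
-- semigroup in it: the starting point of the descent.
missedClass-start : ∀ n .{{_ : NonZero n}} q α β K →
  ∃[ k ] + n ∣ₛ + val α β 0 k ℤ.- missedClass q α β K
missedClass-start n q α β K = k , divides (ℤ.- (w ℤ.* + α)) (begin
  + (k * α) ℤ.- Y₀ ℤ.* + α                             ≡⟨ cong₂ (λ u y → u ℤ.- y ℤ.* + α) (ℤ.pos-* k α) (a≡a%ℕn+[a/ℕn]*n Y₀ n) ⟩
  + k ℤ.* + α ℤ.- (+ k ℤ.+ w ℤ.* + n) ℤ.* + α          ≡⟨ lem (+ k) w (+ n) (+ α) ⟩
  ℤ.- (w ℤ.* + α) ℤ.* + n                              ∎)
  where
  open ≡-Reasoning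
  Y₀ w : ℤ
  Y₀ = K ℤ.* + (q * β) ℤ.+ (+ (q * β) ℤ.- 1ℤ)
  w = Y₀ /ℕ n
  k : ℕ
  k = Y₀ %ℕ n
  lem : ∀ k w n A → k ℤ.* A ℤ.- (k ℤ.+ w ℤ.* n) ℤ.* A ≡ ℤ.- (w ℤ.* A) ℤ.* n
  lem = solve-∀

-- The elimination run backwards: u inverts q α, so - j u plays the part of x, and multiplying the
-- last hypothesis by u q recovers the congruence at x + K. The residue there is e = q β - 1 - k.
missedClass-hit : ∀ n q α β K u j k e → suc k + e ≡ q * β →
  + n ∣ₛ u ℤ.* + (q * α) ℤ.- 1ℤ →
  + n ∣ₛ + val α β j k ℤ.- missedClass q α β K →
  + n ∣ₛ (ℤ.- (+ j ℤ.* u) ℤ.+ K) ℤ.* + (q * β) ℤ.+ + e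
missedClass-hit n q α β K u j k e k+e≡ n∣u n∣v = ∣-≡ (begin
  (+ k ℤ.- Y₀) ℤ.* (u ℤ.* + (q * α) ℤ.- 1ℤ) ℤ.- u ℤ.* + q ℤ.* (+ val α β j k ℤ.- Y₀ ℤ.* + α)
    ≡⟨ cong₂ (λ s v → (+ k ℤ.- Y₀) ℤ.* (u ℤ.* s ℤ.- 1ℤ) ℤ.- u ℤ.* + q ℤ.* (v ℤ.- Y₀ ℤ.* + α))
         (ℤ.pos-* q α) (pos-val α β j k) ⟩
  (+ k ℤ.- Y₀) ℤ.* (u ℤ.* (+ q ℤ.* + α) ℤ.- 1ℤ)
    ℤ.- u ℤ.* + q ℤ.* (+ j ℤ.* + β ℤ.+ + k ℤ.* + α ℤ.- Y₀ ℤ.* + α)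
    ≡⟨ lem₁ (+ j) (+ k) u (+ q) (+ α) (+ β) Y₀ ⟩
  x₀ ℤ.* (+ q ℤ.* + β) ℤ.+ Y₀ ℤ.- + k
    ≡⟨ cong (λ s → x₀ ℤ.* s ℤ.+ Y₀ ℤ.- + k) (ℤ.pos-* q β) ⟨
  x₀ ℤ.* + (q * β) ℤ.+ Y₀ ℤ.- + k
    ≡⟨ lem₂ x₀ K (+ (q * β)) (+ k) ⟩
  (x₀ ℤ.+ K) ℤ.* + (q * β) ℤ.+ (+ (q * β) ℤ.- 1ℤ ℤ.- + k)
    ≡⟨ cong (λ m → (x₀ ℤ.+ K) ℤ.* + (q * β) ℤ.+ m) e≡ ⟩
  (x₀ ℤ.+ K) ℤ.* + (q * β) ℤ.+ + e ∎)
  (∣m∣n⇒∣m-n (∣n⇒∣m*n (+ k ℤ.- Y₀) n∣u) (∣n⇒∣m*n (u ℤ.* + q) n∣v))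
  where
  open ≡-Reasoning
  Y₀ x₀ : ℤ
  Y₀ = K ℤ.* + (q * β) ℤ.+ (+ (q * β) ℤ.- 1ℤ)
  x₀ = ℤ.- (+ j ℤ.* u)
  lem₀ : ∀ k e → 1ℤ ℤ.+ k ℤ.+ e ℤ.- 1ℤ ℤ.- k ≡ e
  lem₀ = solve-∀
  e≡ : + (q * β) ℤ.- 1ℤ ℤ.- + k ≡ + e
  e≡ = trans (cong (λ m → + m ℤ.- 1ℤ ℤ.- + k) (sym k+e≡)) (lem₀ (+ k) (+ e))
  lem₁ : ∀ j k u Q A B Y →
    (k ℤ.- Y) ℤ.* (u ℤ.* (Q ℤ.* A) ℤ.- 1ℤ) ℤ.- u ℤ.* Q ℤ.* (j ℤ.* B ℤ.+ k ℤ.* A ℤ.- Y ℤ.* A)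
    ≡ ℤ.- (j ℤ.* u) ℤ.* (Q ℤ.* B) ℤ.+ Y ℤ.- k
  lem₁ = solve-∀
  lem₂ : ∀ x K S k → x ℤ.* S ℤ.+ (K ℤ.* S ℤ.+ (S ℤ.- 1ℤ)) ℤ.- k ≡ (x ℤ.+ K) ℤ.* S ℤ.+ (S ℤ.- 1ℤ ℤ.- k)
  lem₂ = solve-∀

-- Take β times the first congruence plus α times the second: x cancels. Subtracting α β times the
-- third removes r and leaves j β + k α - (2q - 1) α β.
T-hit : ∀ n p α β x r j k → let q = suc p in
  + n ∣ₛ x ℤ.* + (q * α) ℤ.+ + j →
  + n ∣ₛ (ℤ.- 1ℤ ℤ.- (x ℤ.+ (1ℤ ℤ.- r))) ℤ.* + (q * β) ℤ.+ + k →
  + n ∣ₛ + q ℤ.* r ℤ.- 1ℤ →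
  + n ∣ₛ + val α β j k ℤ.- + Box.T p α β
T-hit n p α β x r j k n∣₁ n∣₂ n∣₃ = ∣-≡
  (trans (cong₂ (λ s t → B ℤ.* (x ℤ.* s ℤ.+ + j) ℤ.+ A ℤ.* (x″ ℤ.* t ℤ.+ + k)
                          ℤ.- A ℤ.* B ℤ.* (Q ℤ.* r ℤ.- 1ℤ)) (ℤ.pos-* q α) (ℤ.pos-* q β))
  (trans (lem x r (+ j) (+ k) A B Q)
         (sym (cong₂ ℤ._-_ (pos-val α β j k) pos-T))))
  (∣m∣n⇒∣m-n (∣m∣n⇒∣m+n (∣n⇒∣m*n B n∣₁) (∣n⇒∣m*n A n∣₂)) (∣n⇒∣m*n (A ℤ.* B) n∣₃))
  where
  q : ℕ
  q = suc p
  Q A B x″ : ℤ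
  Q = + q
  A = + α
  B = + β
  x″ = ℤ.- 1ℤ ℤ.- (x ℤ.+ (1ℤ ℤ.- r))
  pos-T : + Box.T p α β ≡ (Q ℤ.- 1ℤ ℤ.+ Q) ℤ.* (A ℤ.* B)
  pos-T = trans (ℤ.pos-* (p + q) (α * β)) (cong (λ m → + (p + q) ℤ.* m) (ℤ.pos-* α β))
  lem : ∀ x r j k A B Q →
    B ℤ.* (x ℤ.* (Q ℤ.* A) ℤ.+ j)
      ℤ.+ A ℤ.* ((ℤ.- 1ℤ ℤ.- (x ℤ.+ (1ℤ ℤ.- r))) ℤ.* (Q ℤ.* B) ℤ.+ k)
      ℤ.- A ℤ.* B ℤ.* (Q ℤ.* r ℤ.- 1ℤ)
    ≡ j ℤ.* B ℤ.+ k ℤ.* A ℤ.- (Q ℤ.- 1ℤ ℤ.+ Q) ℤ.* (A ℤ.* B)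
  lem = solve-∀

superimposable⇒missed : ∀ {n} .{{_ : NonZero n}} {q α β} → n ≢ 1 →
  q * α ≤ n → gcd n (q * α) ≡ 1 → q * β ≤ n → gcd n (q * β) ≡ 1 →
  (sup : Superimposable (C a z n (q * α)) (C b z n (q * β))) →
  ∀ {j k} → j < q * α → k < q * β → ¬ + n ∣ₛ + val α β j k ℤ.- missedClass q α β (proj₁ sup)
superimposable⇒missed {n} {q} {α} {β} n≢1 qα≤n cop-α qβ≤n cop-β (K , disjoint) {j} {k} j< k< n∣ =
  shared (inverse (gcd≡1⇒coprime cop-α)) (ℕ.m≤n⇒∃[o]m+o≡n k<)
  where
  lem : ∀ j u s → ℤ.- j ℤ.* (u ℤ.* s ℤ.- 1ℤ) ≡ ℤ.- (j ℤ.* u) ℤ.* s ℤ.+ j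
  lem = solve-∀

  shared : ∃[ u ] + n ∣ₛ u ℤ.* + (q * α) ℤ.- 1ℤ → ∃[ e ] suc k + e ≡ q * β → ⊥
  -- The shared position - j u solves x q α ≡ - j modulo n.
  shared (u , n∣u) (e , k+e≡) = disjoint (ℤ.- (+ j ℤ.* u))
    ( occurs-C⇐ qα≤n cop-α n≢1
        (j , j< , ∣-≡ (lem (+ j) u (+ (q * α))) (∣n⇒∣m*n (ℤ.- + j) n∣u))
    , occurs-⊖ K (C b z n (q * β)) (occurs-C⇐ qβ≤n cop-β n≢1
        (e , e<qβ , missedClass-hit n q α β K u j k e k+e≡ n∣u n∣)))
    where
    e<qβ : e < q * β
    e<qβ = ℕ.≤-trans (s≤s (ℕ.m≤n+m e k)) (ℕ.≤-reflexive k+e≡)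

-- Undoing the rotation and then the reversal takes x to -1 - (x + (1 - r)). The two residuals thus
-- describe a position common to the words of the conclusion, and `T-hit` turns it into a box
-- element congruent to T.
box-misses-T : ∀ {n} .{{_ : NonZero n}} q {α β K r x} → Coprime α β →
  (∀ {j k} → j < q * α → k < q * β → ¬ + n ∣ₛ + val α β j k ℤ.- missedClass q α β K) →
  + n ∣ₛ + q ℤ.* r ℤ.- 1ℤ →
  Residual n (q * α) x → ¬ Residual n (q * β) (ℤ.- 1ℤ ℤ.- (x ℤ.+ (1ℤ ℤ.- r)))
-- For q = 0 the bound `j<` is absurd, so q is a successor; α = 0 is excluded likewise.
box-misses-T {n} (suc p) {α} {β} {K} {r} {x} cop missed qr≡1 (j , j< , n∣₁) (k , k< , n∣₂) =
  Box.T-unattained p α β n (missedClass (suc p) α β K) missed {{α≢0}} cop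
    0 (proj₁ start) (proj₂ start) j< k< (T-hit n p α β x r j k n∣₁ n∣₂ qr≡1)
  where
  start : ∃[ k ] + n ∣ₛ + val α β 0 k ℤ.- missedClass (suc p) α β K
  start = missedClass-start n (suc p) α β K
  α≢0 : NonZero α
  α≢0 = ≢-nonZero λ { refl → ℕ.n≮0 (subst (j <_) (ℕ.*-zeroʳ (suc p)) j<) }

theorem3p33 : (n : ℕ) .{{_ : NonZero n}} (q α β : ℕ) →
    gcd α β ≡ 1 →
    q * α ≤ n → gcd n (q * α) ≡ 1 →
    q * β ≤ n → gcd n (q * β) ≡ 1 →
    Superimposable (C a z n (q * α)) (C b z n (q * β)) →
    (r : ℤ) → + n ∣ (+ q ℤ.* r ℤ.- 1ℤ) →
    PerfectlySuperimposable (C a z n (q * α)) (γ^ (1ℤ ℤ.- r) (C~ b z n (q * β)))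
theorem3p33 n q α β cop qα≤n cop-α qβ≤n cop-β sup r qr≡1 x (x∈A , x∈B) = go (n ℕ.≟ 1)
  where
  go : Dec (n ≡ 1) → ⊥
  go (yes refl) = C-1-empty (q * α) (λ ()) x∈A
  go (no n≢1) = box-misses-T q {K = proj₁ sup} {r} {x} (gcd≡1⇒coprime cop)
    (superimposable⇒missed {q = q} n≢1 qα≤n cop-α qβ≤n cop-β sup)
    (∣ᵤ⇒∣ qr≡1)
    (occurs-C⇒ qα≤n cop-α n≢1 (λ ()) x∈A)
    (occurs-C⇒ qβ≤n cop-β n≢1 (λ ())
      (occurs-reverse (C b z n (q * β)) (occurs-γ^ (1ℤ ℤ.- r) (C~ b z n (q * β)) x∈B)))
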